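{- Let $k,d,q \in \mathbb{N}$ satisfy $d \ge k \cdot (4q)^{4k\log k}$. Then there exists a scheme $\beta$ for $T_{k,d}$ such that for every $q$-subset $A \subseteq L(T_{k,d})$ there is a collision with respect to $(A,\beta)$.
   Context: $\log$ denotes the base-2 logarithm. $T_{k,d}$ is the full $k$-ary rooted tree of depth $d$ (root of depth $0$, $k^d$ leaves at depth $d$). $L(T)$ is the set of leaves of a rooted tree $T$, $T^v_{k,d}$ is the subtree of $T_{k,d}$ rooted at $v$, and $\mathsf{Children}(v)$ is the set of children of $v$. A subset $A\subseteq L(T_{k,d})$ is a $q$-subset if $|A|\ge k^d/q$. A scheme for $T_{k,d}$ is a collection $\beta=(f_v)_{v\in V(T_{k,d})}$ where each $f_v$ is a bijection from $L(T^v_{k,d})$ to $\{1,\dots,|L(T^v_{k,d})|\}$. A node $u\in V(T_{k,d})$ forms a collision with respect to $(A,\beta)$ if $A$ contains elements $a_1,\dots,a_k$ such that for each $i\in[k]$, $a_i$ is a descendant of $u_i\in\mathsf{Children}(u)$ where $u_1,\dots,u_k$ are distinct, and $f_{u_1}(a_1)=\dots=f_{u_k}(a_k)$; there is a collision with respect to $(A,\beta)$ if some node forms one. -}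

module Defs where

open import Data.Nat using (ℕ; zero; suc; _+_; _*_; _∸_; _^_; _≤_; _<_)
open import Data.Nat.Properties using (+-comm)
open import Data.Fin using (Fin; toℕ)
open import Data.List using (List; length; _++_; [_])
open import Data.List.Properties using (length-++)
open import Data.List.Membership.Propositional using (_∈_)
open import Data.List.Relation.Unary.All using (All)
open import Data.List.Relation.Unary.Unique.Propositional using (Unique)
open import Data.Product using (Σ; Σ-syntax; ∃; ∃-syntax; _×_; _,_)
open import Function.Bundles using (_⤖_; Bijection)
open import Relation.Binary.PropositionalEquality using (_≡_; sym; subst)

-- Vertices of the full k-ary tree T_{k,d} are words over the alphabet Fin k
-- of length at most d: the root is [], the children of v are v ++ [ i ]
-- (i : Fin k), the depth of v is length v and the leaves are words of length d.

_≼_ : ∀ {k} → List (Fin k) → List (Fin k) → Set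
v ≼ w = ∃[ u ] (v ++ u ≡ w)

LeavesUnder : (k d : ℕ) → List (Fin k) → Set
LeavesUnder k d v = Σ[ ℓ ∈ List (Fin k) ] (length ℓ ≡ d × v ≼ ℓ)

-- A scheme for T_{k,d}: for every vertex v (length v ≤ d) a bijection
-- f_v : L(T^v_{k,d}) → {1,…,|L(T^v_{k,d})|}; here |L(T^v)| = k^(d - depth v)
-- and {1,…,N} is represented by Fin N (values shifted down by one).
Scheme : (k d : ℕ) → Set
Scheme k d = (v : List (Fin k)) → length v ≤ d →
             LeavesUnder k d v ⤖ Fin (k ^ (d ∸ length v))

child≤ : ∀ {k d} (u : List (Fin k)) (i : Fin k) → length u < d →
         length (u ++ [ i ]) ≤ d
child≤ u i p = subst (_≤ _) (sym (trans' (length-++ u) (+-comm (length u) 1))) p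
  where
  trans' : ∀ {a b c : ℕ} → a ≡ b → b ≡ c → a ≡ c
  trans' Relation.Binary.PropositionalEquality.refl q = q

apply : ∀ {k d} → (β : Scheme k d) → (v : List (Fin k)) → (p : length v ≤ d) →
        LeavesUnder k d v → Fin (k ^ (d ∸ length v))
apply β v p a = Bijection.to (β v p) a

FormsCollision : (k d : ℕ) → List (List (Fin k)) → Scheme k d →
                 (u : List (Fin k)) → length u < d → Set
FormsCollision k d A β u p =
  Σ[ a ∈ ((i : Fin k) → LeavesUnder k d (u ++ [ i ])) ]
    (((i : Fin k) → Σ.proj₁ (a i) ∈ A) ×
     ((i j : Fin k) → toℕ (apply β (u ++ [ i ]) (child≤ u i p) (a i))
                    ≡ toℕ (apply β (u ++ [ j ]) (child≤ u j p) (a j))))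

Collision : (k d : ℕ) → List (List (Fin k)) → Scheme k d → Set
Collision k d A β = Σ[ u ∈ List (Fin k) ] Σ[ p ∈ length u < d ] FormsCollision k d A β u p

-- A q-subset of L(T_{k,d}), given as a duplicate-free list of leaves:
-- |A| ≥ k^d / q, i.e. k^d ≤ q * |A| (q ≥ 1).
IsQSubset : (k d q : ℕ) → List (List (Fin k)) → Set
IsQSubset k d q A = All (λ ℓ → length ℓ ≡ d) A × Unique A × (k ^ d ≤ q * length A)

-- The real inequality  d ≥ k · (4q)^(4k·log₂ k)  (k ≥ 1, q ≥ 1), stated in ℕ.
-- With a = (4q)^(4k) ≥ 1 and t = log₂ k ≥ 0 it reads d ≥ k · a^t, which holds
-- iff k · a^(p/s) ≤ d for every rational p/s ≤ t (p ≥ 0, s ≥ 1), i.e. iff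
-- for all p, s ≥ 1 with 2^p ≤ k^s we have a^p · k^s ≤ d^s.
DepthBound : (k q d : ℕ) → Set
DepthBound k q d = (p s : ℕ) → 1 ≤ s → 2 ^ p ≤ k ^ s →
                   ((4 * q) ^ (4 * k)) ^ p * k ^ s ≤ d ^ s

{-# OPTIONS --safe #-}
module Submission where

-- All nodes of the same height h + 1 use the same k labellings of their child subtrees, chosen by induction on h.
-- Call a node balanced for A if A has density at least 1/(4q) below each child.  The labels below a node are assigned
-- one at a time: for a balanced node, each of the first ≈ k^h/(8q) labels, given to uniformly random unused leaves,
-- yields a collision with probability at least 1/E, where E = (8q)^k.  Averaging hence gives a labelling for which
-- the sum of (E/(E-1))^energy(A) over all collision-free A is at most 2^(k^d), energy(A) counting those labels over
-- all balanced nodes.  On the other hand the density of A along a random descending path is a martingale, and an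
-- unbalanced node of large density contributes to its bounded variance.  So most levels are balanced when |A| ≥ k^d/q,
-- the energy is at least E k^d, and (E/(E-1))^E > 2 rules out that A is collision-free.

open import Defs
open import Algebra.Properties.CommutativeMonoid.Sum using ()
open import Algebra.Properties.Semiring.Sum using ()
open import Data.Bool using (Bool; true; false; if_then_else_)
open import Data.Empty using (⊥)
open import Data.Fin using (Fin; zero; suc; toℕ; _↑ˡ_; _↑ʳ_; combine; remQuot; punchIn)
open import Data.Fin.Permutation using (Permutation; _⟨$⟩ʳ_; _⟨$⟩ˡ_; insert; inverseʳ)
import Data.Fin.Permutation as Perm
open import Data.Fin.Properties using (all?; ¬∀⟶∃¬; remQuot-combine; combine-remQuot)
import Data.Fin.Properties as Fin
open import Data.List using (List; []; _∷_; _++_; [_]; length; map; concatMap; allFin; tabulate)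
open import Data.List.Membership.Propositional using (_∈_)
open import Data.List.Membership.Propositional.Properties using (∈-map⁺; ∈-++⁺ˡ; ∈-++⁺ʳ)
open import Data.List.Properties using (length-++; ++-assoc; length-tabulate)
open import Data.List.Relation.Unary.All using (All; []; _∷_)
import Data.List.Relation.Unary.All as All
open import Data.List.Relation.Unary.AllPairs using ([]; _∷_)
open import Data.List.Relation.Unary.Any using (here; there)
open import Data.List.Relation.Unary.Unique.Propositional using (Unique)
open import Data.Nat using (ℕ; zero; suc; _+_; _*_; _∸_; _^_; _/_; _%_; _≤_; _<_; z≤n; s≤s; NonZero; ∣_-_∣; pred; >-nonZero; >-nonZero⁻¹; _≤?_)
open import Data.Nat.DivMod using (m≡m%n+[m/n]*n; m%n<n; m/n*n≤m; m/n<m)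
open import Data.Nat.Properties
open import Data.Nat.Tactic.RingSolver using (solve-∀)
open import Data.Product using (Σ-syntax; ∃; _×_; _,_; proj₁; proj₂)
open import Data.Sum using (_⊎_; inj₁; inj₂)
open import Data.Vec using (Vec; []; _∷_; lookup; toList; fromList; updateAt; replicate; cast)
import Data.Vec.Properties as Vec
open import Function using (_∘_; id)
open import Function.Bundles using (_↔_; mk↔ₛ′; Inverse)
open import Function.Construct.Composition using (_↔-∘_)
open import Function.Properties.Inverse using (↔⇒⤖)
open import Relation.Binary.PropositionalEquality using (_≡_; refl; sym; trans; cong; cong₂; subst; subst₂; module ≡-Reasoning)
open import Relation.Nullary using (Dec; yes; no; contradiction)
open import Relation.Nullary.Decidable using (⌊_⌋)

open Algebra.Properties.Semiring.Sum +-*-semiring using (sum; sum-cong-≗; sum-remove; ∑-distrib-+; *-distribˡ-sum)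
open Algebra.Properties.CommutativeMonoid.Sum *-1-commutativeMonoid using () renaming (sum to prod; sum-cong-≗ to prod-cong-≗; ∑-distrib-+ to prod-distrib-*)

-- Sums and products over Fin n

sum-mono-≤ : ∀ {n} {f g : Fin n → ℕ} → (∀ i → f i ≤ g i) → sum f ≤ sum g
sum-mono-≤ {zero}  f≤g = z≤n
sum-mono-≤ {suc n} f≤g = +-mono-≤ (f≤g zero) (sum-mono-≤ (f≤g ∘ suc))

prod-mono-≤ : ∀ {n} {f g : Fin n → ℕ} → (∀ i → f i ≤ g i) → prod f ≤ prod g
prod-mono-≤ {zero}  f≤g = ≤-refl
prod-mono-≤ {suc n} f≤g = *-mono-≤ (f≤g zero) (prod-mono-≤ (f≤g ∘ suc))

sum-const : ∀ n {c} → sum {n} (λ _ → c) ≡ n * c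
sum-const zero    = refl
sum-const (suc n) = cong (_ +_) (sum-const n)

prod-const : ∀ n {c} → prod {n} (λ _ → c) ≡ c ^ n
prod-const zero    = refl
prod-const (suc n) {c} = cong (c *_) (prod-const n)

prod-^ : ∀ x {n} (f : Fin n → ℕ) → prod (λ i → x ^ f i) ≡ x ^ sum f
prod-^ x {zero}  f = refl
prod-^ x {suc n} f = trans (cong (x ^ f zero *_) (prod-^ x (f ∘ suc))) (sym (^-distribˡ-+-* x (f zero) (sum (f ∘ suc))))

sum-linear : ∀ {n} a b (f g : Fin n → ℕ) → sum (λ i → a * f i + b * g i) ≡ a * sum f + b * sum g
sum-linear a b f g = trans (∑-distrib-+ (λ i → a * f i) (λ i → b * g i))
  (sym (cong₂ _+_ (*-distribˡ-sum a f) (*-distribˡ-sum b g)))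

term≤sum : ∀ {n} (f : Fin n → ℕ) i → f i ≤ sum f
term≤sum f zero    = m≤m+n _ _
term≤sum f (suc i) = ≤-trans (term≤sum (f ∘ suc) i) (m≤n+m _ _)

sum-split : ∀ m n (f : Fin (m + n) → ℕ) → sum f ≡ sum (λ i → f (i ↑ˡ n)) + sum (λ j → f (m ↑ʳ j))
sum-split zero    n f = refl
sum-split (suc m) n f = trans (cong (f zero +_) (sum-split m n (f ∘ suc))) (sym (+-assoc (f zero) _ _))

sum-combine : ∀ m n (f : Fin (m * n) → ℕ) → sum f ≡ sum {m} (λ i → sum {n} (λ j → f (combine i j)))
sum-combine zero    n f = refl
sum-combine (suc m) n f = trans (sum-split n (m * n) f) (cong (sum (λ i → f (i ↑ˡ (m * n))) +_) (sum-combine m n (λ j → f (n ↑ʳ j))))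

-- Sums over lists

∑ : {X : Set} → List X → (X → ℕ) → ℕ
∑ []       f = 0
∑ (x ∷ xs) f = f x + ∑ xs f

module _ {X : Set} where

  ∑-cong : ∀ (xs : List X) {f g : X → ℕ} → (∀ x → f x ≡ g x) → ∑ xs f ≡ ∑ xs g
  ∑-cong []       f≡g = refl
  ∑-cong (x ∷ xs) f≡g = cong₂ _+_ (f≡g x) (∑-cong xs f≡g)

  ∑-mono-≤ : ∀ (xs : List X) {f g : X → ℕ} → (∀ x → f x ≤ g x) → ∑ xs f ≤ ∑ xs g
  ∑-mono-≤ []       f≤g = z≤n
  ∑-mono-≤ (x ∷ xs) f≤g = +-mono-≤ (f≤g x) (∑-mono-≤ xs f≤g)

  ∑-distribˡ-* : ∀ c (xs : List X) (f : X → ℕ) → ∑ xs (λ x → c * f x) ≡ c * ∑ xs f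
  ∑-distribˡ-* c []       f = sym (*-zeroʳ c)
  ∑-distribˡ-* c (x ∷ xs) f = trans (cong (_ +_) (∑-distribˡ-* c xs f)) (sym (*-distribˡ-+ c (f x) _))

  ∑-+ : ∀ (xs : List X) (f g : X → ℕ) → ∑ xs (λ x → f x + g x) ≡ ∑ xs f + ∑ xs g
  ∑-+ []       f g = refl
  ∑-+ (x ∷ xs) f g = trans (cong (_ +_) (∑-+ xs f g)) (interchange (f x) (g x) _ _)
    where
    interchange : ∀ a b c d → (a + b) + (c + d) ≡ (a + c) + (b + d)
    interchange = solve-∀

  ∑-const : ∀ (xs : List X) c → ∑ xs (λ _ → c) ≡ length xs * c
  ∑-const []       c = refl
  ∑-const (x ∷ xs) c = cong (c +_) (∑-const xs c)

  ∑-++ : ∀ (xs ys : List X) (f : X → ℕ) → ∑ (xs ++ ys) f ≡ ∑ xs f + ∑ ys f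
  ∑-++ []       ys f = refl
  ∑-++ (x ∷ xs) ys f = trans (cong (f x +_) (∑-++ xs ys f)) (sym (+-assoc (f x) _ _))

  ∑-tabulate : ∀ {n} (g : Fin n → X) (f : X → ℕ) → ∑ (tabulate g) f ≡ sum (f ∘ g)
  ∑-tabulate {zero}  g f = refl
  ∑-tabulate {suc n} g f = cong (_ +_) (∑-tabulate (g ∘ suc) f)

  term≤∑ : ∀ {xs : List X} (f : X → ℕ) {x} → x ∈ xs → f x ≤ ∑ xs f
  term≤∑ f (here refl) = m≤m+n _ _
  term≤∑ f (there x∈)  = ≤-trans (term≤∑ f x∈) (m≤n+m _ _)

  -- The first-moment argument, carried out as a search: discarding an entry above `c` leaves the
  -- average of the rest at most `c`.
  ∑≤⇒∃≤ : ∀ (xs : List X) (f : X → ℕ) c → 0 < length xs → ∑ xs f ≤ length xs * c → ∃ λ x → f x ≤ c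
  ∑≤⇒∃≤ (x ∷ xs) f c _ = go x xs
    where
    go : ∀ x xs → ∑ (x ∷ xs) f ≤ length (x ∷ xs) * c → ∃ λ x → f x ≤ c
    go x xs le with f x ≤? c
    go x xs       le | yes fx≤c = x , fx≤c
    go x []       le | no  fx≰c = x , subst (_≤ c) (+-identityʳ (f x)) (subst (f x + 0 ≤_) (+-identityʳ c) le)
    go x (y ∷ ys) le | no  fx≰c = go y ys
      (+-cancelˡ-≤ c _ _ (≤-trans (+-monoˡ-≤ (∑ (y ∷ ys) f) (<⇒≤ (≰⇒> fx≰c))) le))

module _ {X Y : Set} where

  ∑-map : ∀ (xs : List X) (g : X → Y) (f : Y → ℕ) → ∑ (map g xs) f ≡ ∑ xs (f ∘ g)
  ∑-map []       g f = refl
  ∑-map (x ∷ xs) g f = cong (_ +_) (∑-map xs g f)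

  ∑-concatMap : ∀ (xs : List X) (g : X → List Y) (f : Y → ℕ) → ∑ (concatMap g xs) f ≡ ∑ xs (λ x → ∑ (g x) f)
  ∑-concatMap []       g f = refl
  ∑-concatMap (x ∷ xs) g f = trans (∑-++ (g x) _ f) (cong (_ +_) (∑-concatMap xs g f))

  ∑-comm : ∀ (xs : List X) (ys : List Y) (f : X → Y → ℕ) →
           ∑ xs (λ x → ∑ ys (f x)) ≡ ∑ ys (λ y → ∑ xs (λ x → f x y))
  ∑-comm []       ys f = sym (trans (∑-const ys 0) (*-zeroʳ (length ys)))
  ∑-comm (x ∷ xs) ys f = trans (cong (_ +_) (∑-comm xs ys f)) (sym (∑-+ ys (f x) _))

vecs : {X : Set} → List X → (k : ℕ) → List (Vec X k)
vecs xs zero    = [] ∷ []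
vecs xs (suc k) = concatMap (λ x → map (x ∷_) (vecs xs k)) xs

∈-vecs : ∀ {X : Set} {xs : List X} {k} (v : Vec X k) → (∀ i → lookup v i ∈ xs) → v ∈ vecs xs k
∈-vecs                   []      _  = here refl
∈-vecs {xs = xs} {suc k} (x ∷ v) v∈ = go (v∈ zero)
  where
  go : ∀ {ys} → x ∈ ys → (x ∷ v) ∈ concatMap (λ y → map (y ∷_) (vecs xs k)) ys
  go (here refl)         = ∈-++⁺ˡ (∈-map⁺ (x ∷_) (∈-vecs v (v∈ ∘ suc)))
  go (there {x = y} x∈) = ∈-++⁺ʳ (map (y ∷_) (vecs xs k)) (go x∈)

-- Distributivity of product over sum. It lets independent coordinates factor, both for random
-- tuples of leaves and for the `k` child subsets of a subset.
∑-vecs-prod : ∀ {X : Set} (xs : List X) {k} (f : Fin k → X → ℕ) →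
              ∑ (vecs xs k) (λ v → prod (λ i → f i (lookup v i))) ≡ prod (λ i → ∑ xs (f i))
∑-vecs-prod xs {zero}  f = refl
∑-vecs-prod xs {suc k} f = begin
  ∑ (concatMap (λ x → map (x ∷_) (vecs xs k)) xs) F              ≡⟨ ∑-concatMap xs _ F ⟩
  ∑ xs (λ x → ∑ (map (x ∷_) (vecs xs k)) F)                      ≡⟨ ∑-cong xs (λ x → ∑-map (vecs xs k) (x ∷_) F) ⟩
  ∑ xs (λ x → ∑ (vecs xs k) (λ v → f zero x * G v))              ≡⟨ ∑-cong xs (λ x → ∑-distribˡ-* (f zero x) (vecs xs k) G) ⟩
  ∑ xs (λ x → f zero x * ∑ (vecs xs k) G)                        ≡⟨ ∑-cong xs (λ x → *-comm (f zero x) _) ⟩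
  ∑ xs (λ x → ∑ (vecs xs k) G * f zero x)                        ≡⟨ ∑-distribˡ-* (∑ (vecs xs k) G) xs (f zero) ⟩
  ∑ (vecs xs k) G * ∑ xs (f zero)                                ≡⟨ *-comm (∑ (vecs xs k) G) _ ⟩
  ∑ xs (f zero) * ∑ (vecs xs k) G                                ≡⟨ cong (∑ xs (f zero) *_) (∑-vecs-prod xs (f ∘ suc)) ⟩
  ∑ xs (f zero) * prod (λ i → ∑ xs (f (suc i)))                  ∎
  where
  open ≡-Reasoning
  F : Vec _ (suc k) → ℕ
  F v = prod (λ i → f i (lookup v i))
  G : Vec _ k → ℕ
  G v = prod (λ i → f (suc i) (lookup v i))

length-vecs : ∀ {X : Set} (xs : List X) k → length (vecs xs k) ≡ length xs ^ k
length-vecs xs k = begin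
  length (vecs xs k)                              ≡⟨ *-identityʳ _ ⟨
  length (vecs xs k) * 1                          ≡⟨ ∑-const (vecs xs k) 1 ⟨
  ∑ (vecs xs k) (λ _ → 1)                         ≡⟨ ∑-cong (vecs xs k) (λ _ → trans (prod-const k) (^-zeroˡ k)) ⟨
  ∑ (vecs xs k) (λ v → prod {k} (λ i → 1))        ≡⟨ ∑-vecs-prod xs {k} (λ _ _ → 1) ⟩
  prod {k} (λ i → ∑ xs (λ _ → 1))                 ≡⟨ prod-const k ⟩
  ∑ xs (λ _ → 1) ^ k                              ≡⟨ cong (_^ k) (trans (∑-const xs 1) (*-identityʳ _)) ⟩
  length xs ^ k                                   ∎
  where open ≡-Reasoning

-- Choosing the labels below one node

⟦_⟧ : Bool → ℕ
⟦ b ⟧ = if b then 1 else 0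

prod-⟦⟧ : ∀ {n} (f : Fin n → Bool) → prod (λ i → ⟦ f i ⟧) ≡ 0 ⊎ (prod (λ i → ⟦ f i ⟧) ≡ 1 × (∀ i → f i ≡ true))
prod-⟦⟧ {zero}  f = inj₂ (refl , λ ())
prod-⟦⟧ {suc n} f with f zero in f₀ | prod-⟦⟧ (f ∘ suc)
... | false | _                 = inj₁ refl
... | true  | inj₁ p≡0          = inj₁ (trans (+-identityʳ _) p≡0)
... | true  | inj₂ (p≡1 , all)  = inj₂ (trans (+-identityʳ _) p≡1 , λ { zero → f₀ ; (suc i) → all i })

prod-⟦⟧≤1 : ∀ {n} (f : Fin n → Bool) → prod (λ i → ⟦ f i ⟧) ≤ 1
prod-⟦⟧≤1 f with prod-⟦⟧ f
... | inj₁ p≡0       rewrite p≡0 = z≤n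
... | inj₂ (p≡1 , _) rewrite p≡1 = ≤-refl

⟦⟧≤1 : ∀ b → ⟦ b ⟧ ≤ 1
⟦⟧≤1 true  = ≤-refl
⟦⟧≤1 false = z≤n

count : ∀ {n} → (Fin n → Bool) → ℕ
count S = sum (λ y → ⟦ S y ⟧)

-- `π i` sends leaves to labels, so `π i ⟨$⟩ˡ y` is the leaf below the `i`-th child that carries the
-- label `y`.
CommonLabel : ∀ {k N} → (Fin k → Fin N → Bool) → (Fin k → Permutation N N) → Set
CommonLabel S π = ∃ λ y → ∀ i → S i (π i ⟨$⟩ˡ y) ≡ true

module Matching (k r b : ℕ) (r^k≡1+b : r ^ k ≡ suc b) where

  -- The factor (1+b)/b that rewards a good item at each step, cleared of its denominator: a good
  -- item gets `suc b`, any other `b`.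
  gain : Bool → ℕ
  gain g = if g then suc b else b

  tuples : ∀ N → List (Vec (Fin (suc N)) k)
  tuples N = vecs (allFin (suc N)) k

  length-tuples : ∀ N → length (tuples N) ≡ suc N ^ k
  length-tuples N = trans (length-vecs (allFin (suc N)) k) (cong (_^ k) (length-tabulate {n = suc N} id))

  module _ {N : ℕ} (S : Fin k → Fin (suc N) → Bool) where

    private
      ts : List (Vec (Fin (suc N)) k)
      ts = tuples N

    hit : Vec (Fin (suc N)) k → ℕ
    hit ρ = prod (λ i → ⟦ S i (lookup ρ i) ⟧)

    ∑-hit : ∑ ts hit ≡ prod (λ i → count (S i))
    ∑-hit = trans (∑-vecs-prod (allFin (suc N)) (λ i y → ⟦ S i y ⟧))
      (prod-cong-≗ (λ i → ∑-tabulate id (λ y → ⟦ S i y ⟧)))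

    misses+hits : ∑ ts (λ ρ → 1 ∸ hit ρ) + ∑ ts hit ≡ length ts
    misses+hits = begin
      ∑ ts (λ ρ → 1 ∸ hit ρ) + ∑ ts hit  ≡⟨ ∑-+ ts _ hit ⟨
      ∑ ts (λ ρ → 1 ∸ hit ρ + hit ρ)         ≡⟨ ∑-cong ts (λ ρ → m∸n+n≡m (prod-⟦⟧≤1 (λ i → S i (lookup ρ i)))) ⟩
      ∑ ts (λ ρ → 1)                         ≡⟨ ∑-const ts 1 ⟩
      length ts * 1                          ≡⟨ *-identityʳ _ ⟩
      length ts                              ∎
      where open ≡-Reasoning

    -- The entries of a uniform tuple are independent and each lies in its set with probability at
    -- least 1/r, so a hit has probability at least 1/r^k = 1/(1+b).
    hits-dense : (∀ i → suc N ≤ r * count (S i)) → length ts ≤ suc b * ∑ ts hit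
    hits-dense dense = begin
      length ts                                   ≡⟨ length-tuples N ⟩
      suc N ^ k                                       ≡⟨ prod-const k ⟨
      prod {k} (λ _ → suc N)                          ≤⟨ prod-mono-≤ dense ⟩
      prod (λ i → r * count (S i))                    ≡⟨ prod-distrib-* (λ _ → r) (λ i → count (S i)) ⟩
      prod {k} (λ _ → r) * prod (λ i → count (S i))   ≡⟨ cong₂ _*_ (trans (prod-const k) r^k≡1+b) (sym ∑-hit) ⟩
      suc b * ∑ ts hit                            ∎
      where open ≤-Reasoning

    -- For a good item the probability of a miss is at most b/(1+b), which reduces the gain 1+b to
    -- `b` on average; for any other item the gain is already `b`.
    misses-gain : ∀ g → (g ≡ true → ∀ i → suc N ≤ r * count (S i)) →
                  gain g * ∑ ts (λ ρ → 1 ∸ hit ρ) ≤ length ts * b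
    misses-gain false _ = begin
      b * Z              ≤⟨ *-monoʳ-≤ b (subst (Z ≤_) misses+hits (m≤m+n Z _)) ⟩
      b * length ts  ≡⟨ *-comm b _ ⟩
      length ts * b  ∎
      where
      open ≤-Reasoning
      Z = ∑ ts (λ ρ → 1 ∸ hit ρ)
    misses-gain true dense = +-cancelʳ-≤ (length ts) _ _ (begin
      suc b * Z + length ts          ≤⟨ +-monoʳ-≤ (suc b * Z) (hits-dense (dense refl)) ⟩
      suc b * Z + suc b * ∑ ts hit   ≡⟨ *-distribˡ-+ (suc b) Z _ ⟨
      suc b * (Z + ∑ ts hit)         ≡⟨ cong (suc b *_) misses+hits ⟩
      suc b * length ts              ≡⟨ swap b (length ts) ⟩
      length ts * b + length ts  ∎)
      where
      open ≤-Reasoning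
      Z = ∑ ts (λ ρ → 1 ∸ hit ρ)
      swap : ∀ b l → suc b * l ≡ l * b + l
      swap = solve-∀

  dense-now : ∀ {N m c} → suc N + r * suc m ≤ r * c + r → suc N ≤ r * c
  dense-now {N} {m} {c} dense = +-cancelʳ-≤ r (suc N) (r * c) (≤-trans (+-monoʳ-≤ (suc N) (m≤m*n r (suc m))) dense)

  -- Using up one leaf and one label lowers the left side of the invariant by 1 + r and the right
  -- side by at most r.
  dense-later : ∀ {N m} {T : Fin (suc N) → Bool} y → suc N + r * suc m ≤ r * count T + r →
                N + r * m ≤ r * count (T ∘ punchIn y) + r
  dense-later {N} {m} {T} y dense = +-cancelˡ-≤ r _ _ (begin
    r + (N + r * m)          ≤⟨ n≤1+n _ ⟩
    suc (r + (N + r * m))    ≡⟨ eq₁ r N m ⟩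
    suc N + r * suc m        ≤⟨ dense ⟩
    r * count T + r          ≡⟨ cong (λ c → r * c + r) (sum-remove {i = y} (λ z → ⟦ T z ⟧)) ⟩
    r * (⟦ T y ⟧ + c) + r    ≤⟨ +-monoˡ-≤ r (*-monoʳ-≤ r (+-monoˡ-≤ c (⟦⟧≤1 (T y)))) ⟩
    r * (1 + c) + r          ≡⟨ eq₂ r c ⟩
    r + (r * c + r)          ∎)
    where
    open ≤-Reasoning
    c = count (T ∘ punchIn y)
    eq₁ : ∀ r N m → suc (r + (N + r * m)) ≡ suc N + r * suc m
    eq₁ = solve-∀
    eq₂ : ∀ r c → r * (1 + c) + r ≡ r + (r * c + r)
    eq₂ = solve-∀

  module _ {I : Set} (F : List I) (good : I → Bool) where

    -- Items that are hit lose all their weight, the others are multiplied by their gain. By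
    -- `misses-gain` the expected total is at most `b` times the old one, and some tuple does no
    -- worse than average.
    choose-tuple : ∀ {N} (w : I → ℕ) (S : I → Fin k → Fin (suc N) → Bool) →
      (∀ x → good x ≡ true → ∀ i → suc N ≤ r * count (S x i)) →
      ∃ λ ρ → ∑ F (λ x → (1 ∸ hit (S x) ρ) * (w x * gain (good x))) ≤ b * ∑ F w
    choose-tuple {N} w S dense = ∑≤⇒∃≤ ts _ _ ts≢[] (begin
      ∑ ts (λ ρ → ∑ F (λ x → (1 ∸ hit (S x) ρ) * (w x * gain (good x))))
        ≡⟨ ∑-comm ts F _ ⟩
      ∑ F (λ x → ∑ ts (λ ρ → (1 ∸ hit (S x) ρ) * (w x * gain (good x))))
        ≡⟨ ∑-cong F (λ x → trans (∑-cong ts (λ ρ → *-comm (1 ∸ hit (S x) ρ) _)) (∑-distribˡ-* (w x * gain (good x)) ts _)) ⟩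
      ∑ F (λ x → w x * gain (good x) * ∑ ts (λ ρ → 1 ∸ hit (S x) ρ))
        ≤⟨ ∑-mono-≤ F (λ x → subst (_≤ w x * (length ts * b)) (sym (*-assoc (w x) _ _)) (*-monoʳ-≤ (w x) (misses-gain (S x) (good x) (dense x)))) ⟩
      ∑ F (λ x → w x * (length ts * b))
        ≡⟨ ∑-cong F (λ x → *-comm (w x) _) ⟩
      ∑ F (λ x → length ts * b * w x)
        ≡⟨ ∑-distribˡ-* (length ts * b) F w ⟩
      length ts * b * ∑ F w
        ≡⟨ *-assoc (length ts) b _ ⟩
      length ts * (b * ∑ F w) ∎)
      where
      open ≤-Reasoning
      ts : List (Vec (Fin (suc N)) k)
      ts = tuples N
      ts≢[] : 0 < length ts
      ts≢[] = subst (0 <_) (sym (length-tuples N)) (m^n>0 (suc N) k)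

    -- A good item is hit by at least a fraction 1/(1+b) of all tuples of preimages of the next label, so some
    -- tuple costs the family the factor b/(1+b) on its good items.
    matching : ∀ {N} m (w : I → ℕ) (S : I → Fin k → Fin N → Bool) → m ≤ N →
      (∀ x → good x ≡ true → ∀ i → N + r * m ≤ r * count (S x i) + r) →
      Σ[ π ∈ (Fin k → Permutation N N) ] Σ[ V ∈ (I → ℕ) ]
        (∑ F V ≤ b ^ m * ∑ F w × (∀ x → CommonLabel (S x) π ⊎ V x ≡ w x * gain (good x) ^ m))
    matching zero w S _ _ =
      (λ _ → Perm.id) , w , ≤-reflexive (sym (+-identityʳ _)) , λ x → inj₂ (sym (*-identityʳ _))
    matching {suc N} (suc m) w S (s≤s m≤N) dense
      with ρ , ρ-bound ← choose-tuple w S (λ x g i → dense-now (dense x g i))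
      with π , V , V-bound , V-spec ← matching m (λ x → (1 ∸ hit (S x) ρ) * (w x * gain (good x)))
                                        (λ x i y → S x i (punchIn (lookup ρ i) y)) m≤N
                                        (λ x g i → dense-later {T = S x i} (lookup ρ i) (dense x g i))
      -- The leaf `lookup ρ i` receives the label `zero`; the recursive labelling of the other
      -- leaves, indexed through `punchIn`, is shifted up by one.
      = (λ i → insert (lookup ρ i) zero (π i)) , V , bound , spec
      where
      bound : ∑ F V ≤ b ^ suc m * ∑ F w
      bound = begin
        ∑ F V                  ≤⟨ V-bound ⟩
        b ^ m * _              ≤⟨ *-monoʳ-≤ (b ^ m) ρ-bound ⟩
        b ^ m * (b * ∑ F w)    ≡⟨ *-assoc (b ^ m) b _ ⟨
        b ^ m * b * ∑ F w      ≡⟨ cong (_* ∑ F w) (*-comm (b ^ m) b) ⟩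
        b ^ suc m * ∑ F w      ∎
        where open ≤-Reasoning

      spec : ∀ x → CommonLabel (S x) (λ i → insert (lookup ρ i) zero (π i)) ⊎ V x ≡ w x * gain (good x) ^ suc m
      spec x with V-spec x
      ... | inj₁ (y , common) = inj₁ (suc y , common)
      ... | inj₂ Vx≡ with prod-⟦⟧ (λ i → S x i (lookup ρ i))
      ...   | inj₂ (_ , common) = inj₁ (zero , common)
      ...   | inj₁ miss = inj₂ (begin
        V x                                                  ≡⟨ Vx≡ ⟩
        (1 ∸ hit (S x) ρ) * (w x * c) * c ^ m                ≡⟨ cong (λ h → (1 ∸ h) * (w x * c) * c ^ m) miss ⟩
        1 * (w x * c) * c ^ m                                ≡⟨ eq (w x) c (c ^ m) ⟩
        w x * c ^ suc m                                      ∎)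
        where
        open ≡-Reasoning
        c = gain (good x)
        eq : ∀ a c d → 1 * (a * c) * d ≡ a * (c * d)
        eq = solve-∀

-- Arithmetic of the variance argument

-- The expansion of (m - n)², with the cross term moved across so that no truncated subtraction
-- occurs.
m*m+n*n≡2mn+∣m-n∣² : ∀ m n → m * m + n * n ≡ 2 * (m * n) + ∣ m - n ∣ * ∣ m - n ∣
m*m+n*n≡2mn+∣m-n∣² zero    n       = refl
m*m+n*n≡2mn+∣m-n∣² (suc m) zero    = eq m
  where
  eq : ∀ m → suc m * suc m + 0 * 0 ≡ 2 * (suc m * 0) + suc m * suc m
  eq = solve-∀
m*m+n*n≡2mn+∣m-n∣² (suc m) (suc n) = begin
  suc m * suc m + suc n * suc n                           ≡⟨ eq₁ m n ⟩
  m * m + n * n + 2 * (1 + m + n)                         ≡⟨ cong (_+ 2 * (1 + m + n)) (m*m+n*n≡2mn+∣m-n∣² m n) ⟩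
  2 * (m * n) + ∣ m - n ∣ * ∣ m - n ∣ + 2 * (1 + m + n)   ≡⟨ eq₂ m n (∣ m - n ∣ * ∣ m - n ∣) ⟩
  2 * (suc m * suc n) + ∣ m - n ∣ * ∣ m - n ∣             ∎
  where
  open ≡-Reasoning
  eq₁ : ∀ m n → suc m * suc m + suc n * suc n ≡ m * m + n * n + 2 * (1 + m + n)
  eq₁ = solve-∀
  eq₂ : ∀ m n x → 2 * (m * n) + x + 2 * (1 + m + n) ≡ 2 * (suc m * suc n) + x
  eq₂ = solve-∀

module _ {k : ℕ} (f : Fin k → ℕ) where

  private
    a sq : ℕ
    a  = sum f
    sq = sum (λ i → f i * f i)

  -- The variance identity for the values `f i`, scaled by `k` so that the mean a/k needs no
  -- division.
  sum-of-deviations : k * k * sq ≡ k * (a * a) + sum (λ i → ∣ k * f i - a ∣ * ∣ k * f i - a ∣)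
  sum-of-deviations = +-cancelʳ-≡ (k * (a * a)) _ _ (begin
    k * k * sq + k * (a * a)
      ≡⟨ cong (k * k * sq +_) (sum-const k) ⟨
    k * k * sq + sum {k} (λ _ → a * a)
      ≡⟨ cong (_+ sum {k} (λ _ → a * a)) (*-distribˡ-sum (k * k) (λ i → f i * f i)) ⟩
    sum (λ i → k * k * (f i * f i)) + sum {k} (λ _ → a * a)
      ≡⟨ ∑-distrib-+ (λ i → k * k * (f i * f i)) (λ _ → a * a) ⟨
    sum (λ i → k * k * (f i * f i) + a * a)
      ≡⟨ sum-cong-≗ (λ i → trans (cong (_+ a * a) (eq₁ k (f i))) (trans (m*m+n*n≡2mn+∣m-n∣² (k * f i) a) (cong (_+ D i) (eq₂ k (f i) a)))) ⟩
    sum (λ i → 2 * (k * a) * f i + D i)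
      ≡⟨ ∑-distrib-+ (λ i → 2 * (k * a) * f i) D ⟩
    sum (λ i → 2 * (k * a) * f i) + sum D
      ≡⟨ cong (_+ sum D) (*-distribˡ-sum (2 * (k * a)) f) ⟨
    2 * (k * a) * a + sum D
      ≡⟨ eq₃ k a (sum D) ⟩
    k * (a * a) + sum D + k * (a * a) ∎)
    where
    open ≡-Reasoning
    D : Fin k → ℕ
    D i = ∣ k * f i - a ∣ * ∣ k * f i - a ∣
    eq₁ : ∀ k x → k * k * (x * x) ≡ k * x * (k * x)
    eq₁ = solve-∀
    eq₂ : ∀ k x a → 2 * (k * x * a) ≡ 2 * (k * a) * x
    eq₂ = solve-∀
    eq₃ : ∀ k a D → 2 * (k * a) * a + D ≡ k * (a * a) + D + k * (a * a)
    eq₃ = solve-∀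

  cauchy-schwarz : .{{NonZero k}} → a * a ≤ k * sq
  cauchy-schwarz = *-cancelˡ-≤ k (begin
    k * (a * a)                  ≤⟨ m≤m+n _ _ ⟩
    k * (a * a) + _              ≡⟨ sum-of-deviations ⟨
    k * k * sq                   ≡⟨ *-assoc k k sq ⟩
    k * (k * sq)                 ∎)
    where open ≤-Reasoning

  cauchy-schwarz-gap : ∀ j → k * (a * a) + ∣ k * f j - a ∣ * ∣ k * f j - a ∣ ≤ k * k * sq
  cauchy-schwarz-gap j = begin
    k * (a * a) + _   ≤⟨ +-monoʳ-≤ (k * (a * a)) (term≤sum (λ i → ∣ k * f i - a ∣ * ∣ k * f i - a ∣) j) ⟩
    k * (a * a) + _   ≡⟨ sum-of-deviations ⟨
    k * k * sq        ∎
    where open ≤-Reasoning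

  -- A value at most half the mean deviates from it by at least half the mean; this single deviation
  -- already gives the extra `a * a`.
  cauchy-schwarz-unbalanced : ∀ j → 2 * (k * f j) ≤ a → 4 * (k * (a * a)) + a * a ≤ 4 * (k * k * sq)
  cauchy-schwarz-unbalanced j low = begin
    4 * (k * (a * a)) + a * a                ≤⟨ +-monoʳ-≤ (4 * (k * (a * a))) (*-mono-≤ a≤2δ a≤2δ) ⟩
    4 * (k * (a * a)) + 2 * δ * (2 * δ)      ≡⟨ eq (k * (a * a)) δ ⟩
    4 * (k * (a * a) + δ * δ)                ≤⟨ *-monoʳ-≤ 4 (cauchy-schwarz-gap j) ⟩
    4 * (k * k * sq)                         ∎
    where
    open ≤-Reasoning
    δ = ∣ k * f j - a ∣
    eq : ∀ x d → 4 * x + 2 * d * (2 * d) ≡ 4 * (x + d * d)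
    eq = solve-∀
    kf≤a : k * f j ≤ a
    kf≤a = ≤-trans (m≤m+n _ _) low
    a≡δ+kf : a ≡ δ + k * f j
    a≡δ+kf = sym (trans (cong (_+ k * f j) (m≤n⇒∣m-n∣≡n∸m kf≤a)) (m∸n+n≡m kf≤a))
    a≤2δ : a ≤ 2 * δ
    a≤2δ = +-cancelʳ-≤ (2 * (k * f j)) a (2 * δ) (begin
      a + 2 * (k * f j)        ≤⟨ +-monoʳ-≤ a low ⟩
      a + a                    ≡⟨ cong (λ x → x + x) a≡δ+kf ⟩
      δ + k * f j + (δ + k * f j)  ≡⟨ eq′ δ (k * f j) ⟩
      2 * δ + 2 * (k * f j)    ∎)
      where
      eq′ : ∀ d x → d + x + (d + x) ≡ 2 * d + 2 * x
      eq′ = solve-∀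

  module _ (q n : ℕ) .{{_ : NonZero k}} where

    private
      S N : ℕ
      S = 16 * q * q * k
      N = k * n

    -- With p = a/N and Var the variance of the child densities f i / n, the claim reads 2qp - 1 ≤ S
    -- (Var + m/N). Here m/N ≥ 1/(8qk), and `S` is chosen so that S/(8qk) = 2q.
    gain-balanced : ∀ m → n ≤ 8 * q * m → a ≤ N → 2 * q * a * N + S * (a * a) ≤ S * k * sq + S * N * m + N * N
    gain-balanced m n≤ a≤N = begin
      2 * q * a * N + S * (a * a)             ≤⟨ +-mono-≤ (*-monoˡ-≤ N (*-monoʳ-≤ (2 * q) a≤N)) (*-monoʳ-≤ S cauchy-schwarz) ⟩
      2 * q * N * N + S * (k * sq)            ≤⟨ +-monoˡ-≤ _ (*-monoˡ-≤ N (*-monoʳ-≤ (2 * q) (*-monoʳ-≤ k n≤))) ⟩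
      2 * q * (k * (8 * q * m)) * N + S * (k * sq)  ≡⟨ eq q k m N sq ⟩
      S * k * sq + S * N * m                  ≤⟨ m≤m+n _ _ ⟩
      S * k * sq + S * N * m + N * N          ∎
      where
      open ≤-Reasoning
      eq : ∀ q k m N s → 2 * q * (k * (8 * q * m)) * N + 16 * q * q * k * (k * s) ≡ 16 * q * q * k * k * s + 16 * q * q * k * N * m
      eq = solve-∀

    -- The same inequality with m = 0, so the variance alone must suffice. If 2qp ≤ 1 the left side
    -- 2qp - 1 is at most 0.
    gain-unbalanced : ∀ j → 4 * q * f j ≤ n → 2 * q * a * N + S * (a * a) ≤ S * k * sq + N * N
    gain-unbalanced j low with 2 * q * a ≤? N
    ... | yes 2qa≤N = begin
      2 * q * a * N + S * (a * a)   ≤⟨ +-mono-≤ (*-monoˡ-≤ N 2qa≤N) (*-monoʳ-≤ S cauchy-schwarz) ⟩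
      N * N + S * (k * sq)          ≡⟨ eq N S k sq ⟩
      S * k * sq + N * N            ∎
      where
      open ≤-Reasoning
      eq : ∀ N S k s → N * N + S * (k * s) ≡ S * k * s + N * N
      eq = solve-∀
    -- Now p > 1/(2q), so the density below `j`, at most 1/(4q), is at most p/2. Then Var ≥ p²/(4k)
    -- and S Var ≥ (2qp)² ≥ 2qp.
    ... | no 2qa≰N = begin
      2 * q * a * N + S * (a * a)                 ≤⟨ +-monoˡ-≤ _ (*-monoʳ-≤ (2 * q * a) N≤2qa) ⟩
      2 * q * a * (2 * q * a) + S * (a * a)       ≡⟨ eq₁ q a k ⟩
      4 * q * q * (4 * (k * (a * a)) + a * a)     ≤⟨ *-monoʳ-≤ (4 * q * q) (cauchy-schwarz-unbalanced j 2kf≤a) ⟩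
      4 * q * q * (4 * (k * k * sq))              ≡⟨ eq₂ q k sq ⟩
      S * k * sq                                  ≤⟨ m≤m+n _ _ ⟩
      S * k * sq + N * N                          ∎
      where
      open ≤-Reasoning
      N≤2qa : N ≤ 2 * q * a
      N≤2qa = <⇒≤ (≰⇒> 2qa≰N)
      -- For q = 0 the inequality `2 * q * a ≤ N` would hold trivially.
      2q>0 : NonZero (2 * q)
      2q>0 = >-nonZero (n≢0⇒n>0 λ 2q≡0 → 2qa≰N (subst (λ x → x * a ≤ N) (sym 2q≡0) z≤n))
      eq₁ : ∀ q a k → 2 * q * a * (2 * q * a) + 16 * q * q * k * (a * a) ≡ 4 * q * q * (4 * (k * (a * a)) + a * a)
      eq₁ = solve-∀
      eq₂ : ∀ q k s → 4 * q * q * (4 * (k * k * s)) ≡ 16 * q * q * k * k * s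
      eq₂ = solve-∀
      eq₃ : ∀ q k x → 2 * q * (2 * (k * x)) ≡ k * (4 * q * x)
      eq₃ = solve-∀
      2kf≤a : 2 * (k * f j) ≤ a
      2kf≤a = *-cancelˡ-≤ (2 * q) {{2q>0}} (begin
        2 * q * (2 * (k * f j))   ≡⟨ eq₃ q k (f j) ⟩
        k * (4 * q * f j)         ≤⟨ *-monoʳ-≤ k low ⟩
        N                         ≤⟨ N≤2qa ⟩
        2 * q * a                 ∎)

-- Growth of the powers of (1+b)/b

^-distribʳ-* : ∀ n x y → (x * y) ^ n ≡ x ^ n * y ^ n
^-distribʳ-* n x y = begin
  (x * y) ^ n                                ≡⟨ prod-const n ⟨
  prod {n} (λ _ → x * y)                     ≡⟨ prod-distrib-* {n} (λ _ → x) (λ _ → y) ⟩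
  prod {n} (λ _ → x) * prod {n} (λ _ → y)    ≡⟨ cong₂ _*_ (prod-const n) (prod-const n) ⟩
  x ^ n * y ^ n                              ∎
  where open ≡-Reasoning

-- `bernoulli` keeps the first two terms of the binomial expansion of (b+1)^(n+1); for n = b they
-- add up to 2 b^(b+1) + b^b.
2*b^[1+b]<[1+b]^[1+b] : ∀ b .{{_ : NonZero b}} → 2 * b ^ suc b < suc b ^ suc b
2*b^[1+b]<[1+b]^[1+b] b = begin-strict
  2 * b ^ suc b                   <⟨ m<m+n _ (m^n>0 b b) ⟩
  2 * b ^ suc b + b ^ b           ≡⟨ eq b (b ^ b) ⟩
  b * b ^ b + suc b * b ^ b       ≤⟨ bernoulli b ⟩
  suc b ^ suc b                   ∎
  where
  open ≤-Reasoning
  eq : ∀ b x → 2 * (b * x) + x ≡ b * x + suc b * x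
  eq = solve-∀
  eq′ : ∀ b x n → b * (b * x) + suc (suc n) * (b * x) + suc n * x ≡ suc b * (b * x + suc n * x)
  eq′ = solve-∀
  bernoulli : ∀ n → b ^ suc n + suc n * b ^ n ≤ suc b ^ suc n
  bernoulli zero    = ≤-reflexive (base b)
    where
    base : ∀ b → b * 1 + 1 * 1 ≡ suc b * 1
    base = solve-∀
  bernoulli (suc n) = begin
    b * (b * b ^ n) + suc (suc n) * (b * b ^ n)                   ≤⟨ m≤m+n _ _ ⟩
    b * (b * b ^ n) + suc (suc n) * (b * b ^ n) + suc n * b ^ n   ≡⟨ eq′ b (b ^ n) n ⟩
    suc b * (b * b ^ n + suc n * b ^ n)                           ≤⟨ *-monoʳ-≤ (suc b) (bernoulli n) ⟩
    suc b * suc b ^ suc n                                         ∎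

-- The `N`-th power of the previous estimate uses up (1+b)N of the `e` factors; for the `t` factors
-- left over, b ≤ 1+b suffices.
2^N*b^e<[1+b]^e : ∀ b .{{_ : NonZero b}} N .{{_ : NonZero N}} e → suc b * N ≤ e → 2 ^ N * b ^ e < suc b ^ e
2^N*b^e<[1+b]^e b N e E*N≤e with t , refl ← m≤n⇒∃[o]m+o≡n E*N≤e = begin-strict
  2 ^ N * b ^ (suc b * N + t)                 ≡⟨ cong (2 ^ N *_) (^-distribˡ-+-* b (suc b * N) t) ⟩
  2 ^ N * (b ^ (suc b * N) * b ^ t)           ≡⟨ *-assoc (2 ^ N) _ _ ⟨
  2 ^ N * b ^ (suc b * N) * b ^ t             ≡⟨ cong (λ x → 2 ^ N * x * b ^ t) (^-*-assoc b (suc b) N) ⟨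
  2 ^ N * (b ^ suc b) ^ N * b ^ t             ≡⟨ cong (_* b ^ t) (^-distribʳ-* N 2 (b ^ suc b)) ⟨
  (2 * b ^ suc b) ^ N * b ^ t                 <⟨ *-monoˡ-< (b ^ t) {{m^n≢0 b t}} (^-monoˡ-< N (2*b^[1+b]<[1+b]^[1+b] b)) ⟩
  (suc b ^ suc b) ^ N * b ^ t                 ≤⟨ *-monoʳ-≤ ((suc b ^ suc b) ^ N) (^-monoˡ-≤ t (n≤1+n b)) ⟩
  (suc b ^ suc b) ^ N * suc b ^ t             ≡⟨ cong (_* suc b ^ t) (^-*-assoc (suc b) (suc b) N) ⟩
  suc b ^ (suc b * N) * suc b ^ t             ≡⟨ ^-distribˡ-+-* (suc b) (suc b * N) t ⟨
  suc b ^ (suc b * N + t)                     ∎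
  where open ≤-Reasoning

-- Subsets of the leaves of a k-ary tree

module Tree (k : ℕ) where

  -- A set of leaves is stored as the tuple of its traces below the `k` children. Induction on the
  -- height is then structural, and the sum over all sets factors over the children.
  Sub : ℕ → Set
  Sub zero    = Bool
  Sub (suc h) = Vec (Sub h) k

  Word : ℕ → Set
  Word = Vec (Fin k)

  infix 4 _∋_
  _∋_ : ∀ {h} → Sub h → Word h → Bool
  _∋_ {zero}  A []      = A
  _∋_ {suc h} A (i ∷ w) = lookup A i ∋ w

  size : ∀ {h} → Sub h → ℕ
  size {zero}  A = ⟦ A ⟧
  size {suc h} A = sum (λ i → size (lookup A i))

  size≤ : ∀ {h} (A : Sub h) → size A ≤ k ^ h
  size≤ {zero}  A = ⟦⟧≤1 A
  size≤ {suc h} A = ≤-trans (sum-mono-≤ (λ i → size≤ (lookup A i))) (≤-reflexive (sum-const k))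

  subs : ∀ h → List (Sub h)
  subs zero    = false ∷ true ∷ []
  subs (suc h) = vecs (subs h) k

  ∈-subs : ∀ {h} (A : Sub h) → A ∈ subs h
  ∈-subs {zero}  false = here refl
  ∈-subs {zero}  true  = there (here refl)
  ∈-subs {suc h} A     = ∈-vecs A (λ i → ∈-subs (lookup A i))

  enc : ∀ {h} → Word h → Fin (k ^ h)
  enc []      = zero
  enc (i ∷ w) = combine i (enc w)

  dec : ∀ {h} → Fin (k ^ h) → Word h
  dec {zero}  _ = []
  dec {suc h} y = proj₁ (remQuot {k} (k ^ h) y) ∷ dec (proj₂ (remQuot {k} (k ^ h) y))

  dec-combine : ∀ {h} (i : Fin k) (y : Fin (k ^ h)) → dec {suc h} (combine i y) ≡ i ∷ dec y
  dec-combine i y = cong (λ p → proj₁ p ∷ dec (proj₂ p)) (remQuot-combine i y)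

  dec-enc : ∀ {h} (w : Word h) → dec (enc w) ≡ w
  dec-enc []      = refl
  dec-enc (i ∷ w) = trans (dec-combine i (enc w)) (cong (i ∷_) (dec-enc w))

  enc-dec : ∀ {h} (y : Fin (k ^ h)) → enc (dec {h} y) ≡ y
  enc-dec {zero}  zero = refl
  enc-dec {suc h} y    = trans (cong (combine (proj₁ (remQuot {k} (k ^ h) y))) (enc-dec {h} _)) (combine-remQuot {k} (k ^ h) y)

  word↔Fin : ∀ h → Word h ↔ Fin (k ^ h)
  word↔Fin h = mk↔ₛ′ enc dec (enc-dec {h}) dec-enc

  leafSet : ∀ {h} → Sub h → Fin (k ^ h) → Bool
  leafSet A y = A ∋ dec y

  count-leafSet : ∀ {h} (A : Sub h) → count (leafSet A) ≡ size A
  count-leafSet {zero}  A = +-identityʳ ⟦ A ⟧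
  count-leafSet {suc h} A = trans (sum-combine k (k ^ h) _)
    (sum-cong-≗ (λ i → trans (sum-cong-≗ (λ y → cong (λ w → ⟦ A ∋ w ⟧) (dec-combine i y))) (count-leafSet (lookup A i))))

  -- `π h i` takes the number of a leaf to its label, in the subtree of height `h` below the `i`-th
  -- child of any node of height h + 1.
  Labelling : Set
  Labelling = ∀ h → Fin k → Permutation (k ^ h) (k ^ h)

  Collides : Labelling → ∀ {h} → Sub h → Set
  Collides π {zero}  A = ⊥
  Collides π {suc h} A = CommonLabel (λ i → leafSet (lookup A i)) (π h) ⊎ ∃ λ i → Collides π (lookup A i)

∃⊎∀ : ∀ {n} {P Q : Fin n → Set} → (∀ i → P i ⊎ Q i) → ∃ P ⊎ (∀ i → Q i)
∃⊎∀ {zero}  PQ = inj₂ λ ()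
∃⊎∀ {suc n} PQ with PQ zero | ∃⊎∀ (PQ ∘ suc)
... | inj₁ p | _             = inj₁ (zero , p)
... | inj₂ _ | inj₁ (i , p)  = inj₁ (suc i , p)
... | inj₂ q | inj₂ qs       = inj₂ λ { zero → q ; (suc i) → qs i }

-- The labelling and its potential

module Potential (k q : ℕ) .{{_ : NonZero k}} .{{_ : NonZero q}} where

  open Tree k

  instance
    8q≢0 : NonZero (8 * q)
    8q≢0 = m*n≢0 8 q

  b : ℕ
  b = pred ((8 * q) ^ k)

  [8q]^k≡1+b : (8 * q) ^ k ≡ suc b
  [8q]^k≡1+b = sym (suc-pred ((8 * q) ^ k) {{m^n≢0 (8 * q) k}})

  open Matching k (8 * q) b [8q]^k≡1+b

  Balanced : ∀ {h} → Sub (suc h) → Set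
  Balanced {h} A = ∀ i → k ^ h ≤ 4 * q * size (lookup A i)

  balanced? : ∀ {h} (A : Sub (suc h)) → Dec (Balanced A)
  balanced? {h} A = all? (λ i → k ^ h ≤? 4 * q * size (lookup A i))

  -- The number of labels per node that count towards the energy. Removing about k^h/(8q) leaves
  -- from a set of density 1/(4q) keeps it 1/(8q)-dense; the `suc` ensures `k^h≤8q*steps`.
  steps : ℕ → ℕ
  steps h = suc (k ^ h / (8 * q))

  steps≤ : ∀ h → steps h ≤ k ^ h
  steps≤ h = m/n<m (k ^ h) (8 * q) {{m^n≢0 k h}} (≤-trans (m≤m+n 2 6) (m≤m*n 8 q))

  k^h≤8q*steps : ∀ h → k ^ h ≤ 8 * q * steps h
  k^h≤8q*steps h = begin
    k ^ h                                              ≡⟨ m≡m%n+[m/n]*n (k ^ h) (8 * q) ⟩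
    k ^ h % (8 * q) + k ^ h / (8 * q) * (8 * q)        ≤⟨ +-monoˡ-≤ _ (<⇒≤ (m%n<n (k ^ h) (8 * q))) ⟩
    8 * q + k ^ h / (8 * q) * (8 * q)                  ≡⟨ *-comm (steps h) (8 * q) ⟩
    8 * q * steps h                                    ∎
    where open ≤-Reasoning

  -- This is the initial invariant for `matching`: density 1/(4q) pays once for `k ^ h` and once for
  -- the labels, and the slack `8 * q` pays for the `suc` in `steps`.
  balanced-dense : ∀ {h} (A : Sub (suc h)) → ⌊ balanced? A ⌋ ≡ true → ∀ i →
    k ^ h + 8 * q * steps h ≤ 8 * q * count (leafSet (lookup A i)) + 8 * q
  balanced-dense {h} A g i with balanced? A
  ... | yes balanced = begin
    n + 8 * q * suc t           ≡⟨ eq₁ n (8 * q) t ⟩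
    n + t * (8 * q) + 8 * q     ≤⟨ +-monoˡ-≤ (8 * q) (+-monoʳ-≤ n (m/n*n≤m n (8 * q))) ⟩
    n + n + 8 * q               ≤⟨ +-monoˡ-≤ (8 * q) (+-mono-≤ (balanced i) (balanced i)) ⟩
    4 * q * a + 4 * q * a + 8 * q  ≡⟨ cong (_+ 8 * q) (eq₂ q a) ⟩
    8 * q * a + 8 * q           ≡⟨ cong (λ x → 8 * q * x + 8 * q) (count-leafSet (lookup A i)) ⟨
    8 * q * count (leafSet (lookup A i)) + 8 * q ∎
    where
    open ≤-Reasoning
    n = k ^ h
    t = n / (8 * q)
    a = size (lookup A i)
    eq₁ : ∀ n r t → n + r * suc t ≡ n + t * r + r
    eq₁ = solve-∀
    eq₂ : ∀ q a → 4 * q * a + 4 * q * a ≡ 8 * q * a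
    eq₂ = solve-∀

  bonus : ∀ {h} → Sub (suc h) → ℕ
  bonus {h} A = if ⌊ balanced? A ⌋ then steps h else 0

  energy : ∀ {h} → Sub h → ℕ
  energy {zero}  A = 0
  energy {suc h} A = sum (λ i → energy (lookup A i)) + bonus A

  -- The energy that a set would have if all nodes were balanced; `b ^ budget h` clears the
  -- denominators of (E/b)^energy, where E = 1 + b.
  budget : ℕ → ℕ
  budget zero    = 0
  budget (suc h) = steps h + k * budget h

  -- `V A` is to be b^budget (E/b)^energy for a collision-free `A`. The bound says that its average
  -- over all 2^(k^h) sets is at most `b ^ budget h`.
  State : ℕ → Set
  State h = Σ[ V ∈ (Sub h → ℕ) ] ∑ (subs h) V ≤ 2 ^ k ^ h * b ^ budget h

  -- `matching` is applied to all sets of height h + 1, each weighted by the product of the old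
  -- weights of its traces. These products sum to the `k`-th power of the old total.
  extend : ∀ {h} (s : State h) → Σ[ π ∈ (Fin k → Permutation (k ^ h) (k ^ h)) ] Σ[ s′ ∈ State (suc h) ]
    (∀ A → CommonLabel (λ i → leafSet (lookup A i)) π
         ⊎ proj₁ s′ A ≡ prod (λ i → proj₁ s (lookup A i)) * gain ⌊ balanced? A ⌋ ^ steps h)
  extend {h} (V , V-bound)
    with π , V′ , V′-bound , spec ← matching (subs (suc h)) (λ A → ⌊ balanced? A ⌋) (steps h)
           (λ A → prod (λ i → V (lookup A i))) (λ A i → leafSet (lookup A i)) (steps≤ h) balanced-dense
    = π , (V′ , bound) , spec
    where
    open ≤-Reasoning
    eq : ∀ x y z → x * (y * z) ≡ y * (x * z)
    eq = solve-∀
    bound : ∑ (subs (suc h)) V′ ≤ 2 ^ k ^ suc h * b ^ budget (suc h)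
    bound = begin
      ∑ (subs (suc h)) V′                                                  ≤⟨ V′-bound ⟩
      b ^ steps h * ∑ (subs (suc h)) (λ A → prod (λ i → V (lookup A i)))   ≡⟨ cong (b ^ steps h *_) (∑-vecs-prod (subs h) {k} (λ _ → V)) ⟩
      b ^ steps h * prod {k} (λ _ → ∑ (subs h) V)                          ≡⟨ cong (b ^ steps h *_) (prod-const k) ⟩
      b ^ steps h * ∑ (subs h) V ^ k                                       ≤⟨ *-monoʳ-≤ (b ^ steps h) (^-monoˡ-≤ k V-bound) ⟩
      b ^ steps h * (2 ^ k ^ h * b ^ budget h) ^ k                         ≡⟨ cong (b ^ steps h *_) (^-distribʳ-* k (2 ^ k ^ h) (b ^ budget h)) ⟩
      b ^ steps h * ((2 ^ k ^ h) ^ k * (b ^ budget h) ^ k)                 ≡⟨ cong (b ^ steps h *_) (cong₂ _*_ (^-*-assoc 2 (k ^ h) k) (^-*-assoc b (budget h) k)) ⟩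
      b ^ steps h * (2 ^ (k ^ h * k) * b ^ (budget h * k))                 ≡⟨ cong₂ (λ x y → b ^ steps h * (2 ^ x * b ^ y)) (*-comm (k ^ h) k) (*-comm (budget h) k) ⟩
      b ^ steps h * (2 ^ k ^ suc h * b ^ (k * budget h))                   ≡⟨ eq (b ^ steps h) (2 ^ k ^ suc h) (b ^ (k * budget h)) ⟩
      2 ^ k ^ suc h * (b ^ steps h * b ^ (k * budget h))                   ≡⟨ cong (2 ^ k ^ suc h *_) (^-distribˡ-+-* b (steps h) (k * budget h)) ⟨
      2 ^ k ^ suc h * b ^ budget (suc h)                                   ∎

  state : ∀ h → State h
  state zero    = (λ _ → 1) , ≤-refl
  state (suc h) = proj₁ (proj₂ (extend (state h)))

  V : ∀ {h} → Sub h → ℕ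
  V {h} = proj₁ (state h)

  π : Labelling
  π h = proj₁ (extend (state h))

  gain-^ : ∀ g m → gain g ^ m * b ^ (if g then m else 0) ≡ suc b ^ (if g then m else 0) * b ^ m
  gain-^ true  m = refl
  gain-^ false m = *-comm (b ^ m) 1

  -- Without a collision the weights of the traces multiply and the root contributes its gain
  -- `steps h` times; the factors `b ^ energy A` and `b ^ budget h` keep the formula free of
  -- fractions.
  collides⊎V : ∀ {h} (A : Sub h) → Collides π A ⊎ V A * b ^ energy A ≡ suc b ^ energy A * b ^ budget h
  collides⊎V {zero}  A = inj₂ refl
  collides⊎V {suc h} A with proj₂ (proj₂ (extend (state h))) A | ∃⊎∀ (λ i → collides⊎V (lookup A i))
  ... | inj₁ common | _              = inj₁ (inj₁ common)
  ... | inj₂ _      | inj₁ collision = inj₁ (inj₂ collision)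
  ... | inj₂ VA≡    | inj₂ VAᵢ≡      = inj₂ (begin
    V A * b ^ (sum eᵢ + δ)                                       ≡⟨ cong₂ _*_ VA≡ (^-distribˡ-+-* b (sum eᵢ) δ) ⟩
    prod Vᵢ * gain g ^ m * (b ^ sum eᵢ * b ^ δ)                  ≡⟨ eq₁ (prod Vᵢ) (gain g ^ m) (b ^ sum eᵢ) (b ^ δ) ⟩
    prod Vᵢ * b ^ sum eᵢ * (gain g ^ m * b ^ δ)                  ≡⟨ cong₂ _*_ prods (gain-^ g m) ⟩
    suc b ^ sum eᵢ * b ^ (k * budget h) * (suc b ^ δ * b ^ m)    ≡⟨ eq₂ (suc b ^ sum eᵢ) (b ^ (k * budget h)) (suc b ^ δ) (b ^ m) ⟩
    suc b ^ sum eᵢ * suc b ^ δ * (b ^ m * b ^ (k * budget h))    ≡⟨ cong₂ _*_ (^-distribˡ-+-* (suc b) (sum eᵢ) δ) (^-distribˡ-+-* b m (k * budget h)) ⟨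
    suc b ^ (sum eᵢ + δ) * b ^ (m + k * budget h)                ∎)
    where
    open ≡-Reasoning
    m = steps h
    g = ⌊ balanced? A ⌋
    δ = bonus A
    eᵢ Vᵢ : Fin k → ℕ
    eᵢ i = energy (lookup A i)
    Vᵢ i = V (lookup A i)
    eq₁ : ∀ x y z t → x * y * (z * t) ≡ x * z * (y * t)
    eq₁ = solve-∀
    eq₂ : ∀ x y z t → x * y * (z * t) ≡ x * z * (t * y)
    eq₂ = solve-∀
    prods : prod Vᵢ * b ^ sum eᵢ ≡ suc b ^ sum eᵢ * b ^ (k * budget h)
    prods = begin
      prod Vᵢ * b ^ sum eᵢ                                                ≡⟨ cong (prod Vᵢ *_) (prod-^ b eᵢ) ⟨
      prod Vᵢ * prod (λ i → b ^ eᵢ i)                                     ≡⟨ prod-distrib-* Vᵢ (λ i → b ^ eᵢ i) ⟨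
      prod (λ i → Vᵢ i * b ^ eᵢ i)                                        ≡⟨ prod-cong-≗ VAᵢ≡ ⟩
      prod (λ i → suc b ^ eᵢ i * b ^ budget h)                            ≡⟨ prod-distrib-* (λ i → suc b ^ eᵢ i) (λ _ → b ^ budget h) ⟩
      prod (λ i → suc b ^ eᵢ i) * prod {k} (λ _ → b ^ budget h)           ≡⟨ cong₂ _*_ (prod-^ (suc b) eᵢ) (prod-const k) ⟩
      suc b ^ sum eᵢ * (b ^ budget h) ^ k                                 ≡⟨ cong (suc b ^ sum eᵢ *_) (trans (^-*-assoc b (budget h) k) (cong (b ^_) (*-comm (budget h) k))) ⟩
      suc b ^ sum eᵢ * b ^ (k * budget h)                                 ∎

  instance
    b≢0 : NonZero b
    b≢0 = >-nonZero (≤-pred (subst (2 ≤_) [8q]^k≡1+b (begin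
      2               ≤⟨ s≤s (s≤s z≤n) ⟩
      8 * 1           ≤⟨ *-monoʳ-≤ 8 (>-nonZero⁻¹ q) ⟩
      8 * q           ≡⟨ ^-identityʳ (8 * q) ⟨
      (8 * q) ^ 1     ≤⟨ ^-monoʳ-≤ (8 * q) (>-nonZero⁻¹ k) ⟩
      (8 * q) ^ k     ∎)))
      where open ≤-Reasoning

  -- A collision-free `A` is one term of the potential, so (E/b)^energy ≤ 2^(k^h), against
  -- `2^N*b^e<[1+b]^e`.
  high-energy⇒collides : ∀ {h} (A : Sub h) → suc b * k ^ h ≤ energy A → Collides π A
  high-energy⇒collides {h} A high with collides⊎V A
  ... | inj₁ collision = collision
  ... | inj₂ VA≡ = contradiction (2^N*b^e<[1+b]^e b (k ^ h) {{m^n≢0 k h}} (energy A) high) (≤⇒≯ (*-cancelʳ-≤ _ _ (b ^ budget h) {{m^n≢0 b (budget h)}} (begin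
    suc b ^ e * b ^ budget h              ≡⟨ VA≡ ⟨
    V A * b ^ e                           ≤⟨ *-monoˡ-≤ (b ^ e) (≤-trans (term≤∑ V (∈-subs A)) (proj₂ (state h))) ⟩
    2 ^ k ^ h * b ^ budget h * b ^ e      ≡⟨ eq (2 ^ k ^ h) (b ^ budget h) (b ^ e) ⟩
    2 ^ k ^ h * b ^ e * b ^ budget h      ∎)))
    where
    open ≤-Reasoning
    e = energy A
    eq : ∀ x y z → x * y * z ≡ x * z * y
    eq = solve-∀

  -- Lower bound on the energy of large sets

  private
    S : ℕ
    S = 16 * q * q * k

  -- The inequality 2qp - 1 ≤ S (Var + bonus/N) at one node: a balanced node is paid for by its
  -- bonus, an unbalanced one by its variance.
  bonus-bound : ∀ {h} (A : Sub (suc h)) → let a = λ i → size (lookup A i) ; N = k ^ suc h in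
    2 * q * size A * N + S * (size A * size A) ≤ S * k * sum (λ i → a i * a i) + S * N * bonus A + N * N
  bonus-bound {h} A with balanced? A
  ... | yes balanced = gain-balanced (λ i → size (lookup A i)) q (k ^ h) (steps h) (k^h≤8q*steps h) (size≤ A)
  ... | no ¬balanced with j , low ← ¬∀⟶∃¬ k _ (λ i → k ^ h ≤? 4 * q * size (lookup A i)) ¬balanced =
    ≤-trans (gain-unbalanced (λ i → size (lookup A i)) q (k ^ h) j (<⇒≤ (≰⇒> low))) (+-monoˡ-≤ (k ^ suc h * k ^ suc h) (m≤m+n _ _))

  -- With p = |A| / N this says energy A ≥ N (h (2qp - 1) / S + p² - p): going up one level, p² - p drops by the
  -- variance of the densities of the subtrees, which is large unless the node is balanced.
  energy-bound : ∀ {h} (A : Sub h) → let a = size A ; N = k ^ h in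
    2 * q * h * N * a + S * (a * a) ≤ S * N * energy A + S * N * a + h * (N * N)
  -- At a leaf p is 0 or 1, so p² - p vanishes, as does the energy.
  energy-bound {zero} false = ≤-reflexive (eq q S)
    where
    eq : ∀ q S → 2 * q * 0 * 1 * 0 + S * 0 ≡ S * 1 * 0 + S * 1 * 0 + 0
    eq = solve-∀
  energy-bound {zero} true = ≤-reflexive (eq q S)
    where
    eq : ∀ q S → 2 * q * 0 * 1 * 1 + S * 1 ≡ S * 1 * 0 + S * 1 * 1 + 0
    eq = solve-∀
  energy-bound {suc h} A = begin
    2 * q * suc h * N * a + S * (a * a)                                            ≡⟨ eq₁ q h k n a S ⟩
    k * (2 * q * h * n * a) + (2 * q * a * N + S * (a * a))                        ≤⟨ +-monoʳ-≤ (k * (2 * q * h * n * a)) (bonus-bound A) ⟩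
    k * (2 * q * h * n * a) + (S * k * sq + S * N * δ + N * N)                     ≡⟨ eq₂ q h k n a S sq δ ⟩
    -- The local inequality has replaced `S * (a * a)` by the second moment of the traces, which the
    -- summed induction hypotheses bound.
    k * (2 * q * h * n * a + S * sq) + (S * N * δ + N * N)                         ≤⟨ +-monoˡ-≤ (S * N * δ + N * N) (*-monoʳ-≤ k summed) ⟩
    k * (S * n * sum eᵢ + S * n * a + k * (h * (n * n))) + (S * N * δ + N * N)     ≡⟨ eq₃ h k n a S (sum eᵢ) δ ⟩
    S * N * (sum eᵢ + δ) + S * N * a + suc h * (N * N)                             ∎
    where
    open ≤-Reasoning
    n = k ^ h
    N = k * n
    δ = bonus A
    aᵢ eᵢ : Fin k → ℕ
    aᵢ i = size (lookup A i)
    eᵢ i = energy (lookup A i)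
    a = sum aᵢ
    sq = sum (λ i → aᵢ i * aᵢ i)
    eq₁ : ∀ q h k n a S → 2 * q * suc h * (k * n) * a + S * (a * a) ≡ k * (2 * q * h * n * a) + (2 * q * a * (k * n) + S * (a * a))
    eq₁ = solve-∀
    eq₂ : ∀ q h k n a S s δ → k * (2 * q * h * n * a) + (S * k * s + S * (k * n) * δ + k * n * (k * n))
                             ≡ k * (2 * q * h * n * a + S * s) + (S * (k * n) * δ + k * n * (k * n))
    eq₂ = solve-∀
    eq₃ : ∀ h k n a S e δ → k * (S * n * e + S * n * a + k * (h * (n * n))) + (S * (k * n) * δ + k * n * (k * n))
                           ≡ S * (k * n) * (e + δ) + S * (k * n) * a + suc h * (k * n * (k * n))
    eq₃ = solve-∀
    summed : 2 * q * h * n * a + S * sq ≤ S * n * sum eᵢ + S * n * a + k * (h * (n * n))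
    summed = begin
      2 * q * h * n * a + S * sq
        ≡⟨ sum-linear (2 * q * h * n) S aᵢ (λ i → aᵢ i * aᵢ i) ⟨
      sum (λ i → 2 * q * h * n * aᵢ i + S * (aᵢ i * aᵢ i))
        ≤⟨ sum-mono-≤ (λ i → energy-bound (lookup A i)) ⟩
      sum (λ i → S * n * eᵢ i + S * n * aᵢ i + h * (n * n))
        ≡⟨ ∑-distrib-+ (λ i → S * n * eᵢ i + S * n * aᵢ i) (λ _ → h * (n * n)) ⟩
      sum (λ i → S * n * eᵢ i + S * n * aᵢ i) + sum {k} (λ _ → h * (n * n))
        ≡⟨ cong₂ _+_ (sum-linear (S * n) (S * n) eᵢ aᵢ) (sum-const k) ⟩
      S * n * sum eᵢ + S * n * a + k * (h * (n * n)) ∎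

  -- For p ≥ 1/q the energy bound gives energy/N ≥ d/S - 1, since 2qp - 1 ≥ 1 and p² - p ≥ -1. With
  -- d ≥ S(E + 1) this is at least E.
  large⇒collides : ∀ {d} → S * suc (suc b) ≤ d → (A : Sub d) → k ^ d ≤ q * size A → Collides π A
  large⇒collides {d} deep A large = high-energy⇒collides A
    (*-cancelˡ-≤ (S * N) {{m*n≢0 S N {{S≢0}} {{m^n≢0 k d}}}} (+-cancelʳ-≤ (S * N * N + d * (N * N)) _ _ (begin
      S * N * (suc b * N) + (S * N * N + d * (N * N))      ≡⟨ eq₁ S N b d ⟩
      S * suc (suc b) * (N * N) + d * (N * N)              ≤⟨ +-monoˡ-≤ (d * (N * N)) (*-monoˡ-≤ (N * N) deep) ⟩
      d * (N * N) + d * (N * N)                            ≡⟨ eq₂ d N ⟩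
      2 * d * N * N                                        ≤⟨ *-monoʳ-≤ (2 * d * N) large ⟩
      2 * d * N * (q * a)                                  ≡⟨ eq₃ d N q a ⟩
      2 * q * d * N * a                                    ≤⟨ m≤m+n _ _ ⟩
      2 * q * d * N * a + S * (a * a)                      ≤⟨ energy-bound A ⟩
      S * N * energy A + S * N * a + d * (N * N)           ≤⟨ +-monoˡ-≤ (d * (N * N)) (+-monoʳ-≤ (S * N * energy A) (*-monoʳ-≤ (S * N) (size≤ A))) ⟩
      S * N * energy A + S * N * N + d * (N * N)           ≡⟨ +-assoc (S * N * energy A) _ _ ⟩
      S * N * energy A + (S * N * N + d * (N * N))         ∎)))
    where
    open ≤-Reasoning
    N = k ^ d
    a = size A
    S≢0 : NonZero S
    S≢0 = m*n≢0 (16 * q * q) k {{m*n≢0 (16 * q) q {{m*n≢0 16 q}}}}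
    eq₁ : ∀ S N b d → S * N * (suc b * N) + (S * N * N + d * (N * N)) ≡ S * suc (suc b) * (N * N) + d * (N * N)
    eq₁ = solve-∀
    eq₂ : ∀ d N → d * (N * N) + d * (N * N) ≡ 2 * d * N * N
    eq₂ = solve-∀
    eq₃ : ∀ d N q a → 2 * d * N * (q * a) ≡ 2 * q * d * N * a
    eq₃ = solve-∀

  -- With Q = (4q)² we have S = Qk and E ≤ Q^k, so S(E + 1) ≤ Q^(k+2) k ≤ Q^(2k) k, the last step by
  -- k ≥ 2.
  depth-suffices : ∀ {d} → 2 ≤ k → (4 * q) ^ (4 * k) * k ≤ d → S * suc (suc b) ≤ d
  depth-suffices {d} 2≤k deep = begin
    16 * q * q * k * suc (suc b)                ≡⟨ eq₁ q k (suc b) ⟩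
    Q * (1 + suc b) * k                         ≤⟨ *-monoˡ-≤ k (*-monoʳ-≤ Q (+-mono-≤ (m^n>0 Q {{Q≢0}} k) E≤Q^k)) ⟩
    Q * (Q ^ k + Q ^ k) * k                     ≤⟨ *-monoˡ-≤ k (*-monoʳ-≤ Q 2Q^k≤) ⟩
    Q * (Q * Q ^ k) * k                         ≡⟨ cong (_* k) (eq₂ Q (Q ^ k)) ⟩
    Q ^ 2 * Q ^ k * k                           ≤⟨ *-monoˡ-≤ k (*-monoˡ-≤ (Q ^ k) (^-monoʳ-≤ Q {{Q≢0}} 2≤k)) ⟩
    Q ^ k * Q ^ k * k                           ≡⟨ cong (_* k) pow ⟩
    (4 * q) ^ (4 * k) * k                       ≤⟨ deep ⟩
    d                                           ∎
    where
    open ≤-Reasoning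
    Q = (4 * q) ^ 2
    Q≢0 : NonZero Q
    Q≢0 = m^n≢0 (4 * q) 2 {{m*n≢0 4 q}}
    eq₁ : ∀ q k e → 16 * q * q * k * suc e ≡ 4 * q * (4 * q * 1) * (1 + e) * k
    eq₁ = solve-∀
    eq₂ : ∀ Q x → Q * (Q * x) ≡ Q * (Q * 1) * x
    eq₂ = solve-∀
    8q≤Q : 8 * q ≤ Q
    8q≤Q = begin
      8 * q                 ≤⟨ *-monoˡ-≤ q {8} {16} (m≤m+n 8 8) ⟩
      16 * q                ≤⟨ m≤m*n (16 * q) q ⟩
      16 * q * q            ≡⟨ eq₃ q ⟩
      Q                     ∎
      where
      eq₃ : ∀ q → 16 * q * q ≡ 4 * q * (4 * q * 1)
      eq₃ = solve-∀
    E≤Q^k : suc b ≤ Q ^ k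
    E≤Q^k = subst (_≤ Q ^ k) [8q]^k≡1+b (^-monoˡ-≤ k 8q≤Q)
    2Q^k≤ : Q ^ k + Q ^ k ≤ Q * Q ^ k
    2Q^k≤ = begin
      Q ^ k + Q ^ k         ≡⟨ cong (Q ^ k +_) (+-identityʳ _) ⟨
      2 * Q ^ k             ≤⟨ *-monoˡ-≤ (Q ^ k) (≤-trans (≤-trans (m≤m+n 2 6) (m≤m*n 8 q)) 8q≤Q) ⟩
      Q * Q ^ k             ∎
    pow : Q ^ k * Q ^ k ≡ (4 * q) ^ (4 * k)
    pow = trans (sym (^-distribˡ-+-* Q k k)) (trans (^-*-assoc (4 * q) 2 (k + k)) (cong ((4 * q) ^_) (eq₄ k)))
      where
      eq₄ : ∀ k → 2 * (k + k) ≡ 4 * k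
      eq₄ = solve-∀

-- Sets of words as subsets of the leaves

sum-updateAt : ∀ {X : Set} {n} (g : X → ℕ) (xs : Vec X n) i (f : X → X) →
  g (f (lookup xs i)) ≡ suc (g (lookup xs i)) →
  sum (λ j → g (lookup (updateAt xs i f) j)) ≡ suc (sum (λ j → g (lookup xs j)))
sum-updateAt g (x ∷ xs) zero    f eq = cong (_+ sum (λ j → g (lookup xs j))) eq
sum-updateAt g (x ∷ xs) (suc i) f eq = trans (cong (g x +_) (sum-updateAt g xs i f eq)) (+-suc (g x) _)

module Words (k : ℕ) where

  open Tree k

  none : ∀ {h} → Sub h
  none {zero}  = false
  none {suc h} = replicate k none

  none-∌ : ∀ {h} (w : Word h) → (none ∋ w) ≡ false
  none-∌ []      = refl
  none-∌ {suc h} (i ∷ w) = trans (cong (_∋ w) (Vec.lookup-replicate i (none {h}))) (none-∌ w)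

  add : ∀ {h} → Word h → Sub h → Sub h
  add []      A = true
  add (i ∷ w) A = updateAt A i (add w)

  size-add : ∀ {h} (w : Word h) (A : Sub h) → (A ∋ w) ≡ false → size (add w A) ≡ suc (size A)
  size-add []      false _  = refl
  size-add (i ∷ w) A     w∉ = sum-updateAt size A i (add w) (size-add w (lookup A i) w∉)

  ∋-add⁻ : ∀ {h} (w : Word h) (A : Sub h) v → (add w A ∋ v) ≡ true → v ≡ w ⊎ (A ∋ v) ≡ true
  ∋-add⁻ []      A []      _  = inj₁ refl
  ∋-add⁻ (i ∷ w) A (j ∷ v) v∈ with j Fin.≟ i
  ... | no j≢i = inj₂ (trans (cong (_∋ v) (sym (Vec.lookup∘updateAt′ j i j≢i A))) v∈)
  ... | yes refl with ∋-add⁻ w (lookup A i) v (trans (cong (_∋ v) (sym (Vec.lookup∘updateAt i A))) v∈)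
  ...   | inj₁ v≡w = inj₁ (cong (i ∷_) v≡w)
  ...   | inj₂ v∈A = inj₂ v∈A

  word : ∀ {n} (ℓ : List (Fin k)) → length ℓ ≡ n → Word n
  word ℓ eq = cast eq (fromList ℓ)

  toList-word : ∀ {n} (ℓ : List (Fin k)) (eq : length ℓ ≡ n) → toList (word ℓ eq) ≡ ℓ
  toList-word ℓ eq = trans (Vec.toList-cast eq (fromList ℓ)) (Vec.toList∘fromList ℓ)

  length-toList : ∀ {n} (w : Word n) → length (toList w) ≡ n
  length-toList []      = refl
  length-toList (_ ∷ w) = cong suc (length-toList w)

  toList-injective : ∀ {n} (v w : Word n) → toList v ≡ toList w → v ≡ w
  toList-injective v w eq = trans (sym (Vec.cast-is-id refl v)) (Vec.toList-injective refl v w eq)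

  fromWords : ∀ {d} (A : List (List (Fin k))) → All (λ ℓ → length ℓ ≡ d) A → Sub d
  fromWords []      []         = none
  fromWords (ℓ ∷ A) (eq ∷ eqs) = add (word ℓ eq) (fromWords A eqs)

  ∋-fromWords⁻ : ∀ {d} A (eqs : All (λ ℓ → length ℓ ≡ d) A) v → (fromWords A eqs ∋ v) ≡ true → toList v ∈ A
  ∋-fromWords⁻ []      []         v v∈ with () ← trans (sym (none-∌ v)) v∈
  ∋-fromWords⁻ (ℓ ∷ A) (eq ∷ eqs) v v∈ with ∋-add⁻ (word ℓ eq) (fromWords A eqs) v v∈
  ... | inj₁ refl = here (toList-word ℓ eq)
  ... | inj₂ v∈A  = there (∋-fromWords⁻ A eqs v v∈A)

  -- As the list has no duplicates, each added word is new and raises the size by one.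
  length≤size-fromWords : ∀ {d} A (eqs : All (λ ℓ → length ℓ ≡ d) A) → Unique A → length A ≤ size (fromWords A eqs)
  length≤size-fromWords []      []         []        = z≤n
  length≤size-fromWords (ℓ ∷ A) (eq ∷ eqs) (ℓ∉ ∷ A!) =
    subst (suc (length A) ≤_) (sym (size-add (word ℓ eq) (fromWords A eqs) new)) (s≤s (length≤size-fromWords A eqs A!))
    where
    new : (fromWords A eqs ∋ word ℓ eq) ≡ false
    new with fromWords A eqs ∋ word ℓ eq in ∋ℓ
    ... | false = refl
    ... | true  = contradiction refl (All.lookup ℓ∉ (subst (_∈ A) (toList-word ℓ eq) (∋-fromWords⁻ A eqs _ ∋ℓ)))

  -- Leaves below a vertex, and the scheme of a labelling

  suffix : ∀ {d} {v : List (Fin k)} → LeavesUnder k d v → List (Fin k)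
  suffix (_ , _ , u , _) = u

  leaf-ext : ∀ {d} {v : List (Fin k)} (ℓ ℓ′ : LeavesUnder k d v) → suffix ℓ ≡ suffix ℓ′ → ℓ ≡ ℓ′
  leaf-ext (_ , eq , u , refl) (_ , eq′ , .u , refl) refl = cong (λ e → _ , e , u , refl) (≡-irrelevant eq eq′)

  length-suffix : ∀ {d} {v : List (Fin k)} (ℓ : LeavesUnder k d v) → length (suffix ℓ) ≡ d ∸ length v
  length-suffix {v = v} (_ , eq , u , refl) =
    sym (trans (cong (_∸ length v) (trans (sym eq) (length-++ v))) (m+n∸m≡n (length v) (length u)))

  leaves↔words : ∀ {d} (v : List (Fin k)) → length v ≤ d → LeavesUnder k d v ↔ Word (d ∸ length v)
  leaves↔words {d} v v≤d = mk↔ₛ′ to from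
    (λ w → toList-injective _ w (toList-word (toList w) (length-suffix (from w))))
    (λ ℓ → leaf-ext (from (to ℓ)) ℓ (toList-word _ (length-suffix ℓ)))
    where
    to : LeavesUnder k d v → Word (d ∸ length v)
    to ℓ = word (suffix ℓ) (length-suffix ℓ)
    from : Word (d ∸ length v) → LeavesUnder k d v
    from w = v ++ toList w , trans (length-++ v) (trans (cong (length v +_) (length-toList w)) (m+[n∸m]≡n v≤d)) , toList w , refl

  last : Fin k → List (Fin k) → Fin k
  last i []      = i
  last _ (i ∷ v) = last i v

  last-∷ʳ : ∀ i₀ u i → last i₀ (u ++ [ i ]) ≡ i
  last-∷ʳ i₀ []      i = refl
  last-∷ʳ i₀ (j ∷ u) i = last-∷ʳ j u i

  label : Labelling → ∀ n → Fin k → Word n ↔ Fin (k ^ n)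
  label π n i = π n i ↔-∘ word↔Fin n

  -- The labels at v depend only on the height of v and on its last letter; the junk letter i₀ serves the root.
  scheme : Labelling → Fin k → ∀ d → Scheme k d
  scheme π i₀ d v v≤d = ↔⇒⤖ (label π (d ∸ length v) (last i₀ v) ↔-∘ leaves↔words v v≤d)

  -- The heights `m` and `n` agree only propositionally, so the two labels lie in different types
  -- and are compared through `toℕ`.
  label-cong : ∀ π {m n} {i j} (v : Word m) (w : Word n) → i ≡ j → toList v ≡ toList w →
    toℕ (Inverse.to (label π m i) v) ≡ toℕ (Inverse.to (label π n j) w)
  label-cong π {m} {n} v w refl eq with refl ← trans (sym (length-toList v)) (trans (cong length eq) (length-toList w))
    with refl ← toList-injective v w eq = refl

  -- The recursive notion of collision turned into the path `u` from the root to the colliding node,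
  -- which has height n + 1, and the common label `y` of the leaves.
  collision-node : ∀ π {h} (A : Sub h) → Collides π A →
    Σ[ u ∈ List (Fin k) ] Σ[ n ∈ ℕ ] (length u + suc n ≡ h × Σ[ y ∈ Fin (k ^ n) ]
      (∀ i → Σ[ v ∈ Word h ] ((A ∋ v) ≡ true × toList v ≡ u ++ i ∷ toList (dec {n} (π n i ⟨$⟩ˡ y)))))
  collision-node π {suc h} A (inj₁ (y , common)) =
    [] , h , refl , y , λ i → i ∷ dec (π h i ⟨$⟩ˡ y) , common i , refl
  collision-node π {suc h} A (inj₂ (j , collision))
    with u , n , eq , y , leaves ← collision-node π (lookup A j) collision =
    j ∷ u , n , cong suc eq , y , λ i → let v , v∈ , v≡ = leaves i in j ∷ v , v∈ , cong (j ∷_) v≡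

  collides⇒collision : ∀ π i₀ {d} A (eqs : All (λ ℓ → length ℓ ≡ d) A) →
    Collides π (fromWords A eqs) → Collision k d A (scheme π i₀ d)
  collides⇒collision π i₀ {d} A eqs collision
    with u , n , eq , y , leaves ← collision-node π (fromWords A eqs) collision =
    u , u<d , leaf , leaf∈ , λ i j → trans (leaf-label i) (sym (leaf-label j))
    where
    u<d : length u < d
    u<d = subst (length u <_) eq (m<m+n (length u) (s≤s z≤n))
    w : Fin k → Word n
    w i = dec (π n i ⟨$⟩ˡ y)
    leaf : ∀ i → LeavesUnder k d (u ++ [ i ])
    leaf i = let v , _ , v≡ = leaves i in
      toList v , length-toList v , toList (w i) , trans (++-assoc u [ i ] (toList (w i))) (sym v≡)
    leaf∈ : ∀ i → proj₁ (leaf i) ∈ A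
    leaf∈ i = let v , v∈ , _ = leaves i in ∋-fromWords⁻ A eqs v v∈
    leaf-label : ∀ i → toℕ (apply (scheme π i₀ d) (u ++ [ i ]) (child≤ u i u<d) (leaf i)) ≡ toℕ y
    -- The last letter of `u ++ [ i ]` is `i`, so the labelling in force is `π n i`, and the leaf
    -- was chosen as the preimage of `y` under it.
    leaf-label i = trans
      (label-cong π (word (suffix (leaf i)) (length-suffix (leaf i))) (w i) (last-∷ʳ i₀ u i) (toList-word _ (length-suffix (leaf i))))
      (cong toℕ (trans (cong (π n i ⟨$⟩ʳ_) (enc-dec {n} (π n i ⟨$⟩ˡ y))) (inverseʳ (π n i))))

-- The unary tree and the general case

theorem11 : (k d q : ℕ) → 1 ≤ k → 1 ≤ q → DepthBound k q d →
    Σ[ β ∈ Scheme k d ]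
    ((A : List (List (Fin k))) → IsQSubset k d q A → Collision k d A β)
-- For k = 1 the logarithm is 0 and the depth bound, at p = 0 and s = 1, gives d ≥ 1. The root then
-- forms a collision with any leaf of `A`.
theorem11 1 d q _ _ deep = scheme (λ _ _ → Perm.id) zero d , collision
  where
  open Words 1
  collision : ∀ A → IsQSubset 1 d q A → Collision 1 d A (scheme (λ _ _ → Perm.id) zero d)
  collision []              (_ , _ , large) = contradiction (subst (1 ^ d ≤_) (*-zeroʳ q) large) (<⇒≱ (m^n>0 1 d))
  collision ([] ∷ A)        (refl ∷ _ , _)  with () ← deep 0 1 ≤-refl ≤-refl
  collision ((zero ∷ w) ∷ A) (eq ∷ _ , _)   =
    [] , subst (0 <_) eq (s≤s z≤n) , (λ { zero → zero ∷ w , eq , w , refl }) , (λ { zero → here refl }) , λ { zero zero → refl }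
theorem11 k@(suc (suc _)) d q _ 1≤q deep = scheme π zero d , λ A (eqs , A! , large) →
  collides⇒collision π zero A eqs (large⇒collides (depth-suffices (s≤s (s≤s z≤n)) deep′) (fromWords A eqs)
    (≤-trans large (*-monoʳ-≤ q (length≤size-fromWords A eqs A!))))
  where
  instance
    q≢0 : NonZero q
    q≢0 = >-nonZero 1≤q
  open Words k
  open Potential k q
  -- The instance p = s = 1 of the depth bound, available because log k ≥ 1 for k ≥ 2.
  deep′ : (4 * q) ^ (4 * k) * k ≤ d
  deep′ = subst₂ _≤_ (cong₂ _*_ (^-identityʳ ((4 * q) ^ (4 * k))) (^-identityʳ k)) (^-identityʳ d)
    (deep 1 1 ≤-refl (≤-trans (s≤s (s≤s z≤n)) (≤-reflexive (sym (^-identityʳ k)))))
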